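{- Let $A$ be a (possibly infinite) alphabet and let $<$ be the generalized lexicographic order induced by a sequence $(<_n)_{n\in\mathbb{N}}$ of total orders on $A$. Let $w$ be a primitive infinite word over $A$. Then $w$ is an infinite generalized Lyndon word if and only if infinitely many of the finite prefixes of $w$ are generalized Lyndon words.
   Context: $\mathbb{N}=\{1,2,3,\dots\}$. Words are finite or infinite (to the right) sequences of letters of $A$. For each $n\in\mathbb{N}$ let $<_n$ be a total order on $A$. The generalized lexicographic order $<$ induced by $(<_n)_{n\in\mathbb{N}}$ on finite and infinite words is: $x<y$ if and only if $x$ is a proper prefix of $y$, or $x=pas$ and $y=pbs'$ for words $p,s,s'$ ($p$ finite) and letters $a,b$ with $a<_{|p|+1}b$. For a nonempty finite word $u$, $u^\omega$ is the infinite word $uuu\cdots$. An infinite word is primitive if it is not of the form $u^\omega$ for any nonempty finite word $u$. A nonempty finite word $w$ is generalized Lyndon if $uv<vu$ for every factorization $w=uv$ with $u,v$ both nonempty. An infinite word $w$ is generalized Lyndon if $w<v$ for every factorization $w=uv$ with $u$ a nonempty finite word. -}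

module Defs where

open import Level using (Level; _⊔_)
open import Data.List.Base using (List; []; _∷_; _++_; length; lookup; applyUpTo)
open import Data.List.NonEmpty.Base using (List⁺; _∷_)
open import Data.Nat.Base using (ℕ; zero; suc; _≤_)
open import Data.Nat.DivMod using (_mod_)
open import Data.Product.Base using (∃-syntax; _×_)
open import Relation.Binary.Core using (Rel)
open import Relation.Binary.PropositionalEquality.Core using (_≡_; _≢_; _≗_)
open import Relation.Nullary.Negation.Core using (¬_)

private
  variable
    a ℓ : Level
    A : Set a

InfWord : Set a → Set a
InfWord A = ℕ → A

data Word (A : Set a) : Set a where
  fin : List A → Word A
  inf : InfWord A → Word A

-- Infinite words are functions, so they are compared pointwise.
data _≈_ {A : Set a} : Word A → Word A → Set a where
  fin : ∀ {x y : List A}    → x ≡ y → fin x ≈ fin y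
  inf : ∀ {x y : InfWord A} → x ≗ y → inf x ≈ inf y

infix 4 _≈_
infixr 5 _++∞_ _⧺_

_++∞_ : List A → InfWord A → InfWord A
([] ++∞ v) n            = v n
((c ∷ u) ++∞ v) zero    = c
((c ∷ u) ++∞ v) (suc n) = (u ++∞ v) n

_⧺_ : List A → Word A → Word A
u ⧺ fin v = fin (u ++ v)
u ⧺ inf v = inf (u ++∞ v)

letter : A → Word A → Word A
letter c s = (c ∷ []) ⧺ s

_^ω : List⁺ A → InfWord A
((c ∷ u) ^ω) n = lookup (c ∷ u) (n mod suc (length u))

Primitive : InfWord A → Set _
Primitive {A = A} w = ∀ (u : List⁺ A) → ¬ (w ≗ u ^ω)

-- Orders are indexed from 0: lt n is the order written <_{n+1} when the
-- sequence starts at 1, so letters following a common prefix p are compared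
-- by lt (length p).
data GenLex {A : Set a} (lt : ℕ → Rel A ℓ) (x y : Word A) : Set (a ⊔ ℓ) where
  properPrefix : ∀ (p : List A) (s : Word A) →
    x ≈ fin p → y ≈ p ⧺ s → s ≢ fin [] → GenLex lt x y
  differ : ∀ (p : List A) (s s′ : Word A) (b c : A) →
    x ≈ p ⧺ letter b s → y ≈ p ⧺ letter c s′ → lt (length p) b c →
    GenLex lt x y

FiniteLyndon : {A : Set a} → (ℕ → Rel A ℓ) → List A → Set (a ⊔ ℓ)
FiniteLyndon {A = A} lt w =
  w ≢ [] ×
  (∀ (u v : List A) → u ≢ [] → v ≢ [] → w ≡ u ++ v →
    GenLex lt (fin (u ++ v)) (fin (v ++ u)))

InfiniteLyndon : {A : Set a} → (ℕ → Rel A ℓ) → InfWord A → Set (a ⊔ ℓ)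
InfiniteLyndon {A = A} lt w =
  ∀ (u : List A) (v : InfWord A) → u ≢ [] → w ≗ u ++∞ v →
    GenLex lt (inf w) (inf v)

prefix : InfWord A → ℕ → List A
prefix = applyUpTo

-- A prefix is determined by its length, so infinitely many prefixes satisfy P
-- exactly when prefixes of unbounded length do.
InfinitelyManyPrefixes : {A : Set a} → (List A → Set ℓ) → InfWord A → Set ℓ
InfinitelyManyPrefixes P w = ∀ N → ∃[ n ] N ≤ n × P (prefix w n)

{-# OPTIONS --safe #-}
-- Write d i for the first position where w differs from its i-th shift, so that
-- i + d i is the first position where the period i of w breaks.  If w is an
-- infinite Lyndon word, every d i exists, and n ↦ n + d n has infinitely many
-- strict records.  At a record n, the prefix of w of length n + d n agrees with
-- the periodic word generated by the prefix of length n, and every comparison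
-- of w with a shift by i < n is decided inside it; hence that prefix of length n
-- is Lyndon.  Conversely, by primitivity w differs from each of its shifts, and
-- the first difference is visible in every sufficiently long Lyndon prefix.
module Submission where

open import Defs
open import Level using (Level; _⊔_; Lift; lift)
open import Axiom.ExcludedMiddle using (ExcludedMiddle)
open import Data.Fin.Base using (toℕ; zero; suc)
open import Data.Fin.Properties using (toℕ-fromℕ<)
open import Data.List.Base using (List; []; _∷_; _++_; length; lookup)
open import Data.List.NonEmpty.Base using (_∷_)
open import Data.List.Properties
  using (∷-injectiveˡ; ∷-injectiveʳ; length-++; length-applyUpTo)
open import Data.Nat.Base
  using (ℕ; zero; suc; _+_; _*_; _≤_; _<_; z≤n; s≤s; z<s; s<s)
open import Data.Nat.DivMod using (_/_; _%_; _mod_; m≡m%n+[m/n]*n; m%n<n)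
open import Data.Nat.Properties
open import Data.Product.Base using (∃-syntax; _×_; _,_; proj₁; proj₂)
open import Function.Base using (_∘_)
open import Function.Bundles using (_⇔_; mk⇔)
open import Relation.Binary.Core using (Rel)
open import Relation.Binary.Definitions using (tri<; tri≈; tri>)
open import Relation.Binary.Structures using (IsStrictTotalOrder)
open import Relation.Binary.PropositionalEquality
  using (_≡_; _≢_; _≗_; refl; sym; trans; cong; cong₂; subst; subst₂; module ≡-Reasoning)
open import Relation.Nullary using (yes; no; contradiction)
open import Relation.Nullary.Decidable using (decidable-stable)

private
  variable
    a ℓ : Level
    A : Set a

-- Records of a sequence of naturals

first-exceeding : ∀ (f : ℕ → ℕ) T b → T < f b →
  ∃[ n ] T < f n × (∀ {i} → i < n → f i ≤ T)
first-exceeding f T zero    T<fb = zero , T<fb , λ ()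
first-exceeding f T (suc b) T<fb with T <? f 0
... | yes T<f0 = zero , T<f0 , λ ()
... | no  T≮f0 with first-exceeding (f ∘ suc) T b T<fb
...   | n , T<fn , below = suc n , T<fn , below′
  where
  below′ : ∀ {i} → i < suc n → f i ≤ T
  below′ {zero}  _         = ≮⇒≥ T≮f0
  below′ {suc i} (s≤s i<n) = below i<n

-- The first index `m` whose value exceeds `f n` is again a record, since all values before it are
-- at most `f n`. It lies beyond `n`, because a record at `n` bounds every earlier value by `f n`.
records-unbounded : ∀ (f : ℕ → ℕ) → (∀ n → n ≤ f n) →
  ∀ N → ∃[ n ] N ≤ n × (∀ {i} → i < n → f i < f n)
records-unbounded f n≤f zero = zero , z≤n , λ ()
records-unbounded f n≤f (suc N) with records-unbounded f n≤f N
-- The search ends because `f n < suc (f n) ≤ f (suc (f n))`.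
... | n , N≤n , rec with first-exceeding f (f n) (suc (f n)) (n≤f (suc (f n)))
...   | m , fn<fm , below = m , ≤-<-trans N≤n n<m , λ i<m → ≤-<-trans (below i<m) fn<fm
  where
  n<m : n < m
  n<m with <-cmp n m
  ... | tri< n<m _ _ = n<m
  ... | tri≈ _ refl _ = contradiction fn<fm (<-irrefl refl)
  ... | tri> _ _ m<n = contradiction (rec m<n) (<-asym fn<fm)

-- Prefixes, shifts and factorizations

shift : ℕ → InfWord A → InfWord A
shift i w j = w (i + j)

prefix-cong : ∀ {f g : InfWord A} n → (∀ {j} → j < n → f j ≡ g j) →
  prefix f n ≡ prefix g n
prefix-cong zero    eq = refl
prefix-cong (suc n) eq = cong₂ _∷_ (eq z<s) (prefix-cong n (eq ∘ s<s))

prefix-injective : ∀ {f g : InfWord A} n → prefix f n ≡ prefix g n →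
  ∀ {j} → j < n → f j ≡ g j
prefix-injective (suc n) eq {zero}  _         = ∷-injectiveˡ eq
prefix-injective (suc n) eq {suc j} (s≤s j<n) = prefix-injective n (∷-injectiveʳ eq) j<n

prefix-+ : ∀ (f : InfWord A) m n → prefix f (m + n) ≡ prefix f m ++ prefix (shift m f) n
prefix-+ f zero    n = refl
prefix-+ f (suc m) n = cong (f 0 ∷_) (prefix-+ (f ∘ suc) m n)

prefix-split : ∀ (f : InfWord A) n u {v} → prefix f n ≡ u ++ v →
  u ≡ prefix f (length u) × v ≡ prefix (shift (length u) f) (length v)
prefix-split f n [] refl = refl , cong (prefix f) (sym (length-applyUpTo f n))
prefix-split f (suc n) (c ∷ u) eq with prefix-split (f ∘ suc) n u (∷-injectiveʳ eq)
... | eqᵘ , eqᵛ = cong₂ _∷_ (sym (∷-injectiveˡ eq)) eqᵘ , eqᵛ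

≗-split : ∀ (f : InfWord A) u {v} → f ≗ u ++∞ v →
  u ≡ prefix f (length u) × v ≗ shift (length u) f
≗-split f []      eq = refl , λ j → sym (eq j)
≗-split f (c ∷ u) eq with ≗-split (f ∘ suc) u (eq ∘ suc)
... | eqᵘ , eqᵛ = cong₂ _∷_ (sym (eq 0)) eqᵘ , eqᵛ

prefix-++∞-< : ∀ (f h : InfWord A) {n j} → j < n → (prefix f n ++∞ h) j ≡ f j
prefix-++∞-< f h {suc n} {zero}  _         = refl
prefix-++∞-< f h {suc n} {suc j} (s≤s j<n) = prefix-++∞-< (f ∘ suc) h j<n

prefix-++∞-+ : ∀ (f h : InfWord A) n j → (prefix f n ++∞ h) (n + j) ≡ h j
prefix-++∞-+ f h zero    j = refl
prefix-++∞-+ f h (suc n) j = prefix-++∞-+ (f ∘ suc) h n j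

prefix-++∞ : ∀ (f h : InfWord A) m n →
  prefix (prefix f m ++∞ h) (m + n) ≡ prefix f m ++ prefix h n
prefix-++∞ f h zero    n = refl
prefix-++∞ f h (suc m) n = cong (f 0 ∷_) (prefix-++∞ (f ∘ suc) h m n)

≗-prefix-shift : ∀ (f : InfWord A) k → f ≗ prefix f k ++∞ shift k f
≗-prefix-shift f zero    j       = refl
≗-prefix-shift f (suc k) zero    = refl
≗-prefix-shift f (suc k) (suc j) = ≗-prefix-shift (f ∘ suc) k j

≗-prefix-letter : ∀ (f : InfWord A) k →
  f ≗ prefix f k ++∞ (f k ∷ []) ++∞ shift (suc k) f
≗-prefix-letter f zero    zero    = refl
≗-prefix-letter f zero    (suc j) = refl
≗-prefix-letter f (suc k) zero    = refl
≗-prefix-letter f (suc k) (suc j) = ≗-prefix-letter (f ∘ suc) k j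

prefix-letter : ∀ (f : InfWord A) k n →
  prefix f (k + suc n) ≡ prefix f k ++ f k ∷ prefix (shift (suc k) f) n
prefix-letter f zero    n = refl
prefix-letter f (suc k) n = cong (f 0 ∷_) (prefix-letter (f ∘ suc) k n)

lookup-prefix : ∀ (f : InfWord A) u → u ≡ prefix f (length u) →
  ∀ j → lookup u j ≡ f (toℕ j)
lookup-prefix f (c ∷ u) eq zero    = ∷-injectiveˡ eq
lookup-prefix f (c ∷ u) eq (suc j) = lookup-prefix (f ∘ suc) u (∷-injectiveʳ eq) j

-- Periodicity

periodic-* : ∀ {f : InfWord A} {n} → f ≗ shift n f → ∀ q j → f (j + q * n) ≡ f j
periodic-* {f = f} {n} per zero    j = cong f (+-identityʳ j)
periodic-* {f = f} {n} per (suc q) j = begin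
  f (j + (n + q * n)) ≡⟨ cong f (+-assoc j n (q * n)) ⟨
  f (j + n + q * n)   ≡⟨ periodic-* per q (j + n) ⟩
  f (j + n)           ≡⟨ cong f (+-comm j n) ⟩
  f (n + j)           ≡⟨ per j ⟨
  f j                 ∎
  where open ≡-Reasoning

-- Links invariance under a shift, which is what the absence of a difference yields, to the form
-- that `Primitive` excludes.
periodic⇒^ω : ∀ (f : InfWord A) c u → c ∷ u ≡ prefix f (suc (length u)) →
  f ≗ shift (suc (length u)) f → f ≗ (c ∷ u) ^ω
periodic⇒^ω f c u eq per j = begin
  f j                          ≡⟨ cong f (m≡m%n+[m/n]*n j n) ⟩
  f (j % n + (j / n) * n)      ≡⟨ periodic-* per (j / n) (j % n) ⟩
  f (j % n)                    ≡⟨ cong f (toℕ-fromℕ< (m%n<n j n)) ⟨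
  f (toℕ (j mod n))            ≡⟨ lookup-prefix f (c ∷ u) eq (j mod n) ⟨
  lookup (c ∷ u) (j mod n)     ∎
  where
  open ≡-Reasoning
  n = suc (length u)

-- The rotation vu of the prefix uv of w, where u and v have lengths i and m, is
-- the prefix of length i + m of the infinite word v w.
rotate : InfWord A → ℕ → ℕ → InfWord A
rotate w i m = prefix (shift i w) m ++∞ w

prefix-rotate : ∀ (w : InfWord A) i m →
  prefix (rotate w i m) (i + m) ≡ prefix (shift i w) m ++ prefix w i
prefix-rotate w i m = trans (cong (prefix (rotate w i m)) (+-comm i m))
                            (prefix-++∞ (shift i w) w m i)

-- Two infinite words, or two finite words of equal length, are never proper prefixes of one
-- another, so `GenLex` between them is always decided at some position `k`. Working with `k`
-- replaces existential factorizations by arithmetic on positions.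
LessAt : {A : Set a} → (ℕ → Rel A ℓ) → ℕ → Rel (InfWord A) _
LessAt lt k f g = (∀ {j} → j < k → f j ≡ g j) × lt k (f k) (g k)

-- Lexicographic comparison by position

module _ {a ℓ : Level} {A : Set a} {lt : ℕ → Rel A ℓ} where

  LessAt-cong : ∀ {k f f′ g g′} → (∀ {j} → j ≤ k → f j ≡ f′ j) →
    (∀ {j} → j ≤ k → g j ≡ g′ j) → LessAt lt k f g → LessAt lt k f′ g′
  LessAt-cong {k} ff′ gg′ (agree , less) =
    (λ j<k → trans (sym (ff′ (<⇒≤ j<k))) (trans (agree j<k) (gg′ (<⇒≤ j<k)))) ,
    subst (λ x → lt k x _) (ff′ ≤-refl) (subst (lt k _) (gg′ ≤-refl) less)

  prefixes⇒LessAt : ∀ {f g : InfWord A} p {b c} →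
    p ≡ prefix f (length p) → p ≡ prefix g (length p) →
    -- The `+ 0` comes from reading the first letter of the shift by `length p`.
    b ≡ f (length p + 0) → c ≡ g (length p + 0) →
    lt (length p) b c → LessAt lt (length p) f g
  prefixes⇒LessAt {f} {g} p pf pg refl refl less =
    prefix-injective (length p) (trans (sym pf) pg) ,
    subst (λ k → lt (length p) (f k) (g k)) (+-identityʳ (length p)) less

  inf⇒LessAt : ∀ {f g : InfWord A} → GenLex lt (inf f) (inf g) → ∃[ k ] LessAt lt k f g
  -- `properPrefix` cannot occur: no infinite word is `≈` to a finite one.
  inf⇒LessAt (differ p (inf s) (inf s′) b c (inf f≗) (inf g≗) less)
    with ≗-split _ p f≗ | ≗-split _ p g≗
  ... | pf , sf | pg , sg = length p , prefixes⇒LessAt p pf pg (sf 0) (sg 0) less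

  LessAt⇒inf : ∀ {f g : InfWord A} {k} → LessAt lt k f g → GenLex lt (inf f) (inf g)
  LessAt⇒inf {f} {g} {k} (agree , less) =
    differ (prefix f k) (inf (shift (suc k) f)) (inf (shift (suc k) g)) (f k) (g k)
      (inf (≗-prefix-letter f k))
      (inf (subst (λ p → g ≗ p ++∞ (g k ∷ []) ++∞ shift (suc k) g)
                  (sym (prefix-cong k agree)) (≗-prefix-letter g k)))
      (subst (λ l → lt l (f k) (g k)) (sym (length-applyUpTo f k)) less)

  fin⇒LessAt : ∀ {f g : InfWord A} n →
    GenLex lt (fin (prefix f n)) (fin (prefix g n)) → ∃[ k ] k < n × LessAt lt k f g
  fin⇒LessAt {f} {g} n (properPrefix p (fin []) _ _ s≢[]) = contradiction refl s≢[]
  fin⇒LessAt {f} {g} n (properPrefix p (fin (c ∷ s)) (fin refl) (fin eq) _) =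
    contradiction lengths (m≢1+m+n n)
    where
    open ≡-Reasoning
    lengths : n ≡ suc (n + length s)
    lengths = begin
      n                                      ≡⟨ length-applyUpTo g n ⟨
      length (prefix g n)                    ≡⟨ cong length eq ⟩
      length (prefix f n ++ c ∷ s)           ≡⟨ length-++ (prefix f n) ⟩
      length (prefix f n) + suc (length s)   ≡⟨ cong (_+ suc (length s)) (length-applyUpTo f n) ⟩
      n + suc (length s)                     ≡⟨ +-suc n (length s) ⟩
      suc (n + length s)                     ∎
  fin⇒LessAt {f} {g} n (differ p (fin s) (fin s′) b c (fin f≡) (fin g≡) less)
    with prefix-split f n p f≡ | prefix-split g n p g≡
  ... | pf , sf | pg , sg =
    length p , subst (length p <_) lengths (m<m+n (length p) z<s) ,
    prefixes⇒LessAt p pf pg (∷-injectiveˡ sf) (∷-injectiveˡ sg) less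
    where
    lengths : length p + suc (length s) ≡ n
    lengths = trans (sym (length-++ p)) (trans (cong length (sym f≡)) (length-applyUpTo f n))

  LessAt⇒fin : ∀ {f g : InfWord A} {k n} → k < n → LessAt lt k f g →
    GenLex lt (fin (prefix f n)) (fin (prefix g n))
  LessAt⇒fin {f} {g} {k} k<n (agree , less) with m≤n⇒∃[o]m+o≡n k<n
  ... | o , refl =
    differ (prefix f k) (fin (prefix (shift (suc k) f) o)) (fin (prefix (shift (suc k) g) o))
      (f k) (g k) (fin (split f))
      (fin (subst (λ p → prefix g (suc k + o) ≡ p ++ g k ∷ prefix (shift (suc k) g) o)
                  (sym (prefix-cong k agree)) (split g)))
      (subst (λ l → lt l (f k) (g k)) (sym (length-applyUpTo f k)) less)
    where
    split : ∀ h → prefix h (suc k + o) ≡ prefix h k ++ h k ∷ prefix (shift (suc k) h) o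
    split h = trans (cong (prefix h) (sym (+-suc k o))) (prefix-letter h k o)

  -- Both uv and vu are prefixes of length `i + m` of infinite words, namely `w` and `rotate w i m`,
  -- so their comparison is decided at a position below `i + m`.
  FiniteLyndon-prefix⇒LessAt : ∀ (w : InfWord A) {i m} → 0 < i → 0 < m →
    FiniteLyndon lt (prefix w (i + m)) → ∃[ k ] k < i + m × LessAt lt k w (rotate w i m)
  FiniteLyndon-prefix⇒LessAt w {i@(suc _)} {m@(suc _)} _ _ (_ , lyndon) =
    fin⇒LessAt (i + m) (subst₂ (λ x y → GenLex lt (fin x) (fin y))
      (sym (prefix-+ w i m)) (sym (prefix-rotate w i m))
      (lyndon (prefix w i) (prefix (shift i w) m) (λ ()) (λ ()) (prefix-+ w i m)))

  LessAt⇒FiniteLyndon-prefix : ∀ (w : InfWord A) {n} → 0 < n →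
    (∀ i m → 0 < i → 0 < m → n ≡ i + m → ∃[ k ] k < n × LessAt lt k w (rotate w i m)) →
    FiniteLyndon lt (prefix w n)
  LessAt⇒FiniteLyndon-prefix w {n@(suc _)} _ less = (λ ()) , rotation
    where
    0<length : ∀ {x : List A} → x ≢ [] → 0 < length x
    0<length {[]}    x≢[] = contradiction refl x≢[]
    0<length {_ ∷ _} _    = z<s

    rotation : ∀ u v → u ≢ [] → v ≢ [] → prefix w n ≡ u ++ v →
      GenLex lt (fin (u ++ v)) (fin (v ++ u))
    rotation u v u≢[] v≢[] eq =
      let u≡ , v≡ = prefix-split w n u eq
          k , k<n , w<rotate = less i m (0<length u≢[]) (0<length v≢[]) n≡i+m
          rotated = begin
            prefix (rotate w i m) n              ≡⟨ cong (prefix (rotate w i m)) n≡i+m ⟩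
            prefix (rotate w i m) (i + m)        ≡⟨ prefix-rotate w i m ⟩
            prefix (shift i w) m ++ prefix w i   ≡⟨ cong₂ _++_ v≡ u≡ ⟨
            v ++ u                               ∎
      in subst₂ (λ x y → GenLex lt (fin x) (fin y)) eq rotated (LessAt⇒fin k<n w<rotate)
      where
      open ≡-Reasoning
      i = length u
      m = length v
      n≡i+m : n ≡ i + m
      n≡i+m = trans (sym (length-applyUpTo w n)) (trans (cong length eq) (length-++ u))

  -- The two implications

  module _ (sto : ∀ n → IsStrictTotalOrder _≡_ (lt n)) (w : InfWord A) where

    lt⇒≢ : ∀ {n x y} → lt n x y → x ≢ y
    lt⇒≢ less eq = IsStrictTotalOrder.irrefl (sto _) eq less

    -- The rotation equals the shift by `i` up to position `m`; from there on it restarts `w`, while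
    -- the shift reads `w` from `i + m` on. These agree as long as the period `i + m` persists, and
    -- `i + k < i + m + d` says that the comparison is decided before that period breaks.
    LessAt-shift⇒rotate : ∀ {i m k d} → 0 < i →
      (∀ {j} → j < d → w j ≡ w (i + m + j)) → i + k < i + m + d →
      LessAt lt k w (shift i w) → k < i + m × LessAt lt k w (rotate w i m)
    LessAt-shift⇒rotate {i} {m} {k} {d} 0<i per i+k<n+d less@(agree , w<) =
      k<n , LessAt-cong (λ _ → refl) (sym ∘ rotate≡shift) less
      where
      n = i + m

      rotate≡shift : ∀ {j} → j ≤ k → rotate w i m j ≡ shift i w j
      rotate≡shift {j} j≤k with j <? m
      ... | yes j<m = prefix-++∞-< (shift i w) w j<m
      ... | no  j≮m with m≤n⇒∃[o]m+o≡n (≮⇒≥ j≮m)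
      ...   | j′ , refl = begin
        rotate w i m (m + j′) ≡⟨ prefix-++∞-+ (shift i w) w m j′ ⟩
        w j′                  ≡⟨ per j′<d ⟩
        w (n + j′)            ≡⟨ cong w (+-assoc i m j′) ⟩
        w (i + (m + j′))      ∎
        where
        open ≡-Reasoning
        j′<d : j′ < d
        -- Here `n + j′ = i + j ≤ i + k < n + d`.
        j′<d = +-cancelˡ-< n j′ d
          (subst (_< n + d) (sym (+-assoc i m j′))
            (≤-<-trans (+-monoʳ-≤ i j≤k) i+k<n+d))

      -- If n ≤ k, removing the period n from the positions k and i + k turns
      -- them into k ∸ n and i + (k ∸ n), where w and its shift still agree.
      k<n : k < n
      k<n with k <? n
      ... | yes k<n = k<n
      ... | no  k≮n with m≤n⇒∃[o]m+o≡n (≮⇒≥ k≮n)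
      ...   | k′ , refl = contradiction eq (lt⇒≢ w<)
        where
        open ≡-Reasoning
        i+n+k′≡ : i + (n + k′) ≡ n + (i + k′)
        i+n+k′≡ = trans (sym (+-assoc i n k′))
          (trans (cong (_+ k′) (+-comm i n)) (+-assoc n i k′))
        i+k′<d : i + k′ < d
        i+k′<d = +-cancelˡ-< n (i + k′) d (subst (_< n + d) i+n+k′≡ i+k<n+d)
        eq : w (n + k′) ≡ w (i + (n + k′))
        eq = begin
          w (n + k′)       ≡⟨ per (≤-<-trans (m≤n+m k′ i) i+k′<d) ⟨
          w k′             ≡⟨ agree (m<n+m k′ (≤-trans 0<i (m≤m+n i m))) ⟩
          w (i + k′)       ≡⟨ per i+k′<d ⟩
          w (n + (i + k′)) ≡⟨ cong w i+n+k′≡ ⟨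
          w (i + (n + k′)) ∎

    infinite⇒prefixes : InfiniteLyndon lt w → InfinitelyManyPrefixes (FiniteLyndon lt) w
    infinite⇒prefixes lyndon N =
      let n , N≤n , record-at-n = records-unbounded break
            (λ i → ≤-trans (n≤1+n i) (m≤m+n (suc i) (d i))) N
      in suc n , m≤n⇒m≤1+n N≤n , prefix-lyndon n record-at-n
      where
      -- Index `i` stands for the shift by `suc i`, since the removed prefix must be nonempty; a
      -- record at `n` therefore gives a Lyndon prefix of length `suc n`.
      first : ∀ i → ∃[ k ] LessAt lt k w (shift (suc i) w)
      first i = inf⇒LessAt (lyndon (prefix w (suc i)) _ (λ ()) (≗-prefix-shift w (suc i)))

      d : ℕ → ℕ
      d i = proj₁ (first i)

      break : ℕ → ℕ
      break i = suc i + d i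

      prefix-lyndon : ∀ n → (∀ {i} → i < n → break i < break n) →
        FiniteLyndon lt (prefix w (suc n))
      prefix-lyndon n record-at-n = LessAt⇒FiniteLyndon-prefix w z<s λ where
        -- Matching `refl` makes `n` equal to `i + m`, so `i < n` and the record property gives
        -- `break i < break n`, the bound required.
        (suc i) m _ 0<m refl →
          d i , LessAt-shift⇒rotate z<s (proj₁ (proj₂ (first n)))
                  (record-at-n (m<m+n i 0<m)) (proj₂ (first i))

    prefixes⇒infinite : ExcludedMiddle (a ⊔ ℓ) → Primitive w →
      InfinitelyManyPrefixes (FiniteLyndon lt) w → InfiniteLyndon lt w
    prefixes⇒infinite em aperiodic lyndon [] v u≢[] w≗uv = contradiction refl u≢[]
    prefixes⇒infinite em aperiodic lyndon (c ∷ u) v u≢[] w≗uv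
      -- Excluded middle decides whether `w` and `v` differ somewhere; `Lift` only adjusts the
      -- universe level.
      with ≗-split w (c ∷ u) w≗uv | em {P = Lift ℓ (∃[ k ] w k ≢ v k)}
    ... | u≡ , v≗ | no w≗v =
      contradiction (periodic⇒^ω w c u u≡ λ j → trans (w≡v j) (v≗ j)) (aperiodic (c ∷ u))
      where
      w≡v : w ≗ v
      -- Trichotomy of one order, here the one of index 0, makes equality of letters decidable and
      -- hence stable.
      w≡v j = decidable-stable (IsStrictTotalOrder._≟_ (sto 0) (w j) (v j))
                (λ w≢v → w≗v (lift (j , w≢v)))
    -- This length makes the part after `c ∷ u` longer than `l`, so the rotation still agrees with
    -- `v` at the difference `l`.
    ... | u≡ , v≗ | yes (lift (l , wl≢vl)) with lyndon (suc (length u) + suc l)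
    ...   | n , i+l<n , prefix-lyndon with m≤n⇒∃[o]m+o≡n i+l<n
    ...     | o , refl = LessAt⇒inf (LessAt-cong (λ _ → refl)
                (λ j≤k → rotate≡v (≤-<-trans j≤k (≤-<-trans k≤l l<m))) w<rot)
      where
      i = suc (length u)
      m = suc l + o
      l<m : l < m
      l<m = m≤m+n (suc l) o
      rotate≡v : ∀ {j} → j < m → rotate w i m j ≡ v j
      rotate≡v j<m = trans (prefix-++∞-< (shift i w) w j<m) (sym (v≗ _))
      w<rotate : ∃[ k ] k < i + m × LessAt lt k w (rotate w i m)
      w<rotate = FiniteLyndon-prefix⇒LessAt w z<s z<s
        (subst (FiniteLyndon lt ∘ prefix w) (+-assoc i (suc l) o) prefix-lyndon)
      w<rot = proj₂ (proj₂ w<rotate)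
      k≤l : proj₁ w<rotate ≤ l
      -- If `l < k`, then `w` would agree at `l` with the rotation, and so with `v`.
      k≤l = ≮⇒≥ λ l<k → wl≢vl (trans (proj₁ w<rot l<k) (rotate≡v l<m))

theorem8 : ∀ {a ℓ : Level} → ExcludedMiddle (a ⊔ ℓ) →
    (A : Set a) (lt : ℕ → Rel A ℓ) →
    (∀ n → IsStrictTotalOrder _≡_ (lt n)) →
    (w : InfWord A) → Primitive w →
    InfiniteLyndon lt w ⇔ InfinitelyManyPrefixes (FiniteLyndon lt) w
theorem8 em A lt sto w aperiodic =
  mk⇔ (infinite⇒prefixes sto w) (prefixes⇒infinite sto w em aperiodic)
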